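{- Let $\mathbf A$ be a complete residuated lattice, $I$ a set, and $O\colon A^I\to A^I$ an interior operator satisfying $d^I\cdot O(x)\le O(d^I\cdot x)$ for all $d\in A$ and $x\in A^I$. Then there exist a set $J$ and a fuzzy relation $R\colon I\times J\to A$ such that $O(x)=\rho_R(\phi_R(x))$ for all $x\in A^I$. (One may take $J=\{O(a)\mid a\in A^I\}$ and $R(i,O(a))=O(a)(i)$.)
   Context: A residuated lattice is an algebra $\mathbf A=(A;\vee,\wedge,\cdot,\rightarrow,0,1)$ such that $(A;\vee,\wedge,0,1)$ is a bounded lattice, $(A;\cdot,1)$ is a commutative monoid, and $x\cdot y\le z$ iff $x\le y\rightarrow z$; complete if the lattice reduct is complete. $A^K$ carries componentwise operations and order; $d^K$ is the constant element with value $d\in A$. An interior operator is a monotone $O$ with $O(x)\le x$ and $O(O(x))=O(x)$. For $R\colon I\times J\to A$: $\phi_R\colon A^I\to A^J$, $\phi_R(x)(j)=\bigwedge_{i\in I}(R(i,j)\rightarrow x(i))$; $\rho_R\colon A^J\to A^I$, $\rho_R(y)(i)=\bigvee_{j\in J}(R(i,j)\cdot y(j))$. -}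

module Defs where

open import Algebra.Core using (Op₁; Op₂)
open import Algebra.Structures using (IsCommutativeMonoid)
open import Data.Product using (∃-syntax; _×_; proj₁)
open import Function.Base using (const; flip)
open import Level using (Level; _⊔_; suc)
open import Relation.Binary.Core using (Rel)
open import Relation.Binary.Definitions using (Monotonic₁)
open import Relation.Binary.Lattice using (Exponential; IsBoundedLattice)

private
  variable
    a k ℓ ℓ₁ ℓ₂ : Level

IsSup : {A : Set a} → Rel A ℓ → {K : Set k} → (K → A) → A → Set (a ⊔ k ⊔ ℓ)
IsSup _≤_ f s = (∀ i → f i ≤ s) × (∀ z → (∀ i → f i ≤ z) → s ≤ z)

IsInf : {A : Set a} → Rel A ℓ → {K : Set k} → (K → A) → A → Set (a ⊔ k ⊔ ℓ)
IsInf _≤_ = IsSup (flip _≤_)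

record IsInteriorOperator {A : Set a} (_≈_ : Rel A ℓ₁) (_≤_ : Rel A ℓ₂)
                          (O : Op₁ A) : Set (a ⊔ ℓ₁ ⊔ ℓ₂) where
  field
    monotone   : Monotonic₁ _≤_ _≤_ O
    deflating  : ∀ x → O x ≤ x
    idempotent : ∀ x → O (O x) ≈ O x

record ResiduatedLattice c ℓ₁ ℓ₂ : Set (suc (c ⊔ ℓ₁ ⊔ ℓ₂)) where
  infix  4 _≈_ _≤_
  infixr 5 _⇒_
  infixr 6 _∨_
  infixr 7 _∧_
  infixl 8 _·_
  field
    Carrier             : Set c
    _≈_                 : Rel Carrier ℓ₁
    _≤_                 : Rel Carrier ℓ₂
    _∨_ _∧_ _·_ _⇒_     : Op₂ Carrier
    0# 1#               : Carrier
    isBoundedLattice    : IsBoundedLattice _≈_ _≤_ _∨_ _∧_ 1# 0#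
    isCommutativeMonoid : IsCommutativeMonoid _≈_ _·_ 1#
    -- `Exponential` is stated for an arbitrary binary operation, here _·_.
    residuation         : Exponential _≤_ _·_ _⇒_

-- Completeness is stated for families rather than subsets.  The index types
-- live in the least universe that contains both the subtypes of the carrier
-- (so that arbitrary subsets are covered) and the images of such families.
record CompleteResiduatedLattice c ℓ₁ ℓ₂ : Set (suc (c ⊔ ℓ₁ ⊔ ℓ₂)) where
  field
    residuatedLattice : ResiduatedLattice c ℓ₁ ℓ₂

  open ResiduatedLattice residuatedLattice public

  field
    ⋁ ⋀   : {K : Set (c ⊔ ℓ₁ ⊔ ℓ₂)} → (K → Carrier) → Carrier
    ⋁-sup : {K : Set (c ⊔ ℓ₁ ⊔ ℓ₂)} (f : K → Carrier) → IsSup _≤_ f (⋁ f)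
    ⋀-inf : {K : Set (c ⊔ ℓ₁ ⊔ ℓ₂)} (f : K → Carrier) → IsInf _≤_ f (⋀ f)

module Fuzzy {c ℓ₁ ℓ₂} (A : CompleteResiduatedLattice c ℓ₁ ℓ₂) where
  open CompleteResiduatedLattice A

  Index : Set (suc (c ⊔ ℓ₁ ⊔ ℓ₂))
  Index = Set (c ⊔ ℓ₁ ⊔ ℓ₂)

  infixl 8 _^_
  _^_ : ∀ {a k} → Set a → Set k → Set (a ⊔ k)
  X ^ K = K → X

  infix  4 _≈̇_ _≤̇_
  infixl 8 _·̇_

  _≈̇_ : {K : Index} → Rel (Carrier ^ K) (c ⊔ ℓ₁ ⊔ ℓ₂)
  x ≈̇ y = ∀ i → x i ≈ y i

  _≤̇_ : {K : Index} → Rel (Carrier ^ K) (c ⊔ ℓ₁ ⊔ ℓ₂)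
  x ≤̇ y = ∀ i → x i ≤ y i

  _·̇_ : {K : Index} → Op₂ (Carrier ^ K)
  (x ·̇ y) i = x i · y i

  FuzzyRel : Index → Index → Set (c ⊔ ℓ₁ ⊔ ℓ₂)
  FuzzyRel I J = I → J → Carrier

  module _ {I J : Index} (R : FuzzyRel I J) where

    φ : Carrier ^ I → Carrier ^ J
    φ x j = ⋀ (λ i → R i j ⇒ x i)

    ρ : Carrier ^ J → Carrier ^ I
    ρ y i = ⋁ (λ j → R i j · y j)

  module _ {I : Index} (O : Op₁ (Carrier ^ I)) where

    -- {O(a) ∣ a ∈ A^I}: equal members may be repeated, which does not affect
    -- joins over this type.
    Image : Index
    Image = ∃[ y ] ∃[ a ] O a ≈̇ y

    imageRel : FuzzyRel I Image
    imageRel i y = proj₁ y i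

{-# OPTIONS --safe #-}
-- For y in the image of O, the degree φ x y is the largest d with d · y ≤ x.
-- Members of the image are fixed by O, so d · y = d · O y ≤ O (d · y) ≤ O x,
-- whence ρ (φ x) ≤ O x.  Conversely the member y = O x ≤ x has φ x y ≥ 1 and
-- contributes O x to the join.
module Submission where

open import Defs
open import Algebra.Core using (Op₁)
open import Algebra.Structures using (IsCommutativeMonoid)
open import Data.Product using (Σ-syntax; _×_; _,_; proj₁; proj₂)
open import Function.Base using (const)
open import Relation.Binary.Bundles using (Poset)
open import Relation.Binary.Lattice using (IsBoundedLattice)
import Relation.Binary.Reasoning.PartialOrder as PosetReasoning

module _ {c ℓ₁ ℓ₂} (A : CompleteResiduatedLattice c ℓ₁ ℓ₂) where
  open CompleteResiduatedLattice A
  open Fuzzy A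
  open IsCommutativeMonoid isCommutativeMonoid
    using (comm; identityˡ; identityʳ; ∙-congˡ)

  private
    poset : Poset c ℓ₁ ℓ₂
    poset = record
      { isPartialOrder = IsBoundedLattice.isPartialOrder isBoundedLattice }

    open Poset poset using (refl; reflexive; trans; antisym; module Eq)
    open PosetReasoning poset

  -- Residuation makes multiplication by `z` a lower adjoint, hence monotone: the unit of the
  -- adjunction gives `x ≤ y ≤ z ⇒ y · z`, and transposing back yields the claim.
  ·-monoˡ-≤ : ∀ z {x y} → x ≤ y → x · z ≤ y · z
  ·-monoˡ-≤ z {x} {y} x≤y =
    proj₂ (residuation x z (y · z))
      (trans x≤y (proj₁ (residuation y z (y · z)) refl))

  ·-monoʳ-≤ : ∀ z {x y} → x ≤ y → z · x ≤ z · y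
  ·-monoʳ-≤ z {x} {y} x≤y = begin
    z · x  ≈⟨ comm z x ⟩
    x · z  ≤⟨ ·-monoˡ-≤ z x≤y ⟩
    y · z  ≈⟨ comm y z ⟩
    z · y  ∎

  module _ {I J : Index} (R : FuzzyRel I J) (x : Carrier ^ I) where

    φ-greatest : ∀ j d → (∀ i → d · R i j ≤ x i) → d ≤ φ R x j
    φ-greatest j d d·R≤x =
      proj₂ (⋀-inf (λ i → R i j ⇒ x i)) d
        (λ i → proj₁ (residuation d (R i j) (x i)) (d·R≤x i))

    φ·R≤x : ∀ j i → φ R x j · R i j ≤ x i
    φ·R≤x j i =
      proj₂ (residuation (φ R x j) (R i j) (x i))
        (proj₁ (⋀-inf (λ k → R k j ⇒ x k)) i)

  module _ {I : Index} {O : Op₁ (Carrier ^ I)}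
           (isInterior : IsInteriorOperator _≈̇_ _≤̇_ O)
           (strong : ∀ (d : Carrier) (x : Carrier ^ I) →
                     const d ·̇ O x ≤̇ O (const d ·̇ x))
           where
    open IsInteriorOperator isInterior

    -- In effect, `strong` makes the fixed points of `O` closed under scaling, so a multiple of
    -- `O a` below `x` passes below `O x` as any fixed point would. Idempotence supplies the outer
    -- `O` past which the scalar can move.
    scaled-image-≤ : ∀ d a {x} → const d ·̇ O a ≤̇ x → const d ·̇ O a ≤̇ O x
    scaled-image-≤ d a {x} d·Oa≤x i = begin
      d · O a i              ≈⟨ ∙-congˡ (idempotent a i) ⟨
      d · O (O a) i          ≤⟨ strong d (O a) i ⟩
      O (const d ·̇ O a) i   ≤⟨ monotone d·Oa≤x i ⟩
      O x i                  ∎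

    ρφ≤O : ∀ x → ρ (imageRel O) (φ (imageRel O) x) ≤̇ O x
    ρφ≤O x i =
      proj₂ (⋁-sup (λ j → imageRel O i j · φ (imageRel O) x j)) (O x i) bound
      where
      bound : ∀ j → imageRel O i j · φ (imageRel O) x j ≤ O x i
      -- `scaled-image-≤` speaks of values of `O`, so `y` is traded for `O a`; the scalar is the
      -- degree `φ (imageRel O) x j`.
      bound j@(y , a , Oa≈y) = begin
        y i · d    ≈⟨ comm (y i) d ⟩
        d · y i    ≈⟨ ∙-congˡ (Oa≈y i) ⟨
        d · O a i  ≤⟨ scaled-image-≤ d a d·Oa≤x i ⟩
        O x i      ∎
        where
        d : Carrier
        d = φ (imageRel O) x j

        -- Required at every coordinate `k`, not just at `i`, since `O` need not act componentwise.
        d·Oa≤x : const d ·̇ O a ≤̇ x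
        d·Oa≤x k = begin
          d · O a k  ≈⟨ ∙-congˡ (Oa≈y k) ⟩
          d · y k    ≤⟨ φ·R≤x (imageRel O) x j k ⟩
          x k        ∎

    O≤ρφ : ∀ x → O x ≤̇ ρ (imageRel O) (φ (imageRel O) x)
    O≤ρφ x i = begin
      O x i                            ≈⟨ identityʳ (O x i) ⟨
      O x i · 1#                       ≤⟨ ·-monoʳ-≤ (O x i) 1≤φ ⟩
      O x i · φ (imageRel O) x j       ≤⟨ proj₁ (⋁-sup (λ k → imageRel O i k · φ (imageRel O) x k)) j ⟩
      ρ (imageRel O) (φ (imageRel O) x) i  ∎
      where
      j : Image O
      j = O x , x , λ _ → Eq.refl

      -- The unit is an admissible scalar for the member `O x` because `O` is deflating.
      1≤φ : 1# ≤ φ (imageRel O) x j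
      1≤φ = φ-greatest (imageRel O) x j 1#
        (λ k → trans (reflexive (identityˡ (O x k))) (deflating x k))

    O≈ρφ : ∀ x → O x ≈̇ ρ (imageRel O) (φ (imageRel O) x)
    O≈ρφ x i = antisym (O≤ρφ x i) (ρφ≤O x i)

theorem4 : ∀ {c ℓ₁ ℓ₂} (A : CompleteResiduatedLattice c ℓ₁ ℓ₂) →
    let open CompleteResiduatedLattice A
        open Fuzzy A in
    (I : Index) (O : Op₁ (Carrier ^ I)) →
    IsInteriorOperator _≈̇_ _≤̇_ O →
    (∀ (d : Carrier) (x : Carrier ^ I) → const d ·̇ O x ≤̇ O (const d ·̇ x)) →
    (Σ[ J ∈ Index ] Σ[ R ∈ FuzzyRel I J ] (∀ x → O x ≈̇ ρ R (φ R x)))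
    × (∀ x → O x ≈̇ ρ (imageRel O) (φ (imageRel O) x))
theorem4 A I O isInterior strong =
  (Image O , imageRel O , representation) , representation
  where
  open CompleteResiduatedLattice A
  open Fuzzy A

  representation : ∀ x → O x ≈̇ ρ (imageRel O) (φ (imageRel O) x)
  representation = O≈ρφ A isInterior strong
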